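{- Let $\mathbb{F}$ be a field and let $n\ge 1$. Define the polynomial in the $3n$ variables $x_1,\dots,x_n,y_1,\dots,y_n,z_1,\dots,z_n$ \[ Q_n=\sum_{i=1}^n z_i\prod_{j=1}^n\bigl(x_j+y_{(j+i)\bmod n}\bigr), \] where indices of $y$ are taken modulo $n$ in $\{1,\dots,n\}$. If $A$ is a read-$k$ oblivious ABP of width $w$ computing $Q_n$, then $w\ge \exp\bigl(n/k^{O(k)}\bigr)$ (the constant in the $O(\cdot)$ being absolute).
   Context: An algebraic branching program (ABP) over $\mathbb{F}$ is a directed acyclic graph whose vertices are partitioned into layers $0,1,\dots,L$, with a single source in layer $0$ and a single sink in layer $L$, edges only from layer $\ell-1$ to layer $\ell$, each edge labeled by a polynomial; it computes the sum over all source–sink paths of the product of the edge labels on the path. Its width is the maximum number of vertices in a layer. It is oblivious if for every layer $\ell$ all edge labels in that layer are univariate polynomials in a single variable $x_{i_\ell}$ (the layer "reads" that variable). An oblivious ABP is read-$k$ if each variable is read in at most $k$ layers. -}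

module Defs where

open import Level using (Level; _⊔_; suc; Setω)
open import Algebra.Bundles using (CommutativeRing)
open import Data.Nat as ℕ using (ℕ; zero; _≤_; NonZero)
open import Data.Nat.DivMod using (_mod_)
open import Data.Fin as Fin using (Fin; _↑ˡ_; _↑ʳ_)
open import Data.Fin.Properties using () renaming (_≟_ to _≟ᶠ_)
open import Data.Vec as Vec using (Vec; replicate; zipWith; updateAt)
open import Data.Vec.Properties using (≡-dec)
open import Data.List as List using (List; []; _∷_; _++_; concatMap; map; foldr; allFin)
open import Data.Product using (Σ; _×_; _,_; ∃-syntax)
open import Relation.Nullary using (¬_; yes; no)
open import Relation.Binary.PropositionalEquality using (_≡_)

record Field (c ℓ : Level) : Set (suc (c ⊔ ℓ)) where
  field
    commutativeRing : CommutativeRing c ℓ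
  open CommutativeRing commutativeRing public
  field
    1≉0     : ¬ (1# ≈ 0#)
    inverse : ∀ x → ¬ (x ≈ 0#) → Σ Carrier (λ y → (x * y) ≈ 1#)

module Poly {c ℓ : Level} (F : Field c ℓ) where
  open Field F

  Monomial : ℕ → Set
  Monomial m = Vec ℕ m

  -- a multivariate polynomial in m variables: a finite formal sum of
  -- terms (coefficient, monomial); repeated monomials are allowed.
  MPoly : ℕ → Set c
  MPoly m = List (Carrier × Monomial m)

  coeff : ∀ {m} → MPoly m → Monomial m → Carrier
  coeff []             μ = 0#
  coeff ((a , ν) ∷ p) μ with ≡-dec ℕ._≟_ ν μ
  ... | yes _ = a + coeff p μ
  ... | no  _ = coeff p μ

  _≈ₚ_ : ∀ {m} → MPoly m → MPoly m → Set ℓ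
  p ≈ₚ q = ∀ μ → coeff p μ ≈ coeff q μ

  0ₚ : ∀ {m} → MPoly m
  0ₚ = []

  1ₚ : ∀ {m} → MPoly m
  1ₚ {m} = (1# , replicate m 0) ∷ []

  _+ₚ_ : ∀ {m} → MPoly m → MPoly m → MPoly m
  p +ₚ q = p ++ q

  _*ₚ_ : ∀ {m} → MPoly m → MPoly m → MPoly m
  p *ₚ q = concatMap (λ { (a , μ) → map (λ { (b , ν) → (a * b , zipWith ℕ._+_ μ ν) }) q }) p

  xpow : ∀ {m} → Fin m → ℕ → Monomial m
  xpow {m} i e = updateAt (replicate m 0) i (λ _ → e)

  var : ∀ {m} → Fin m → MPoly m
  var i = (1# , xpow i 1) ∷ []

  -- univariate polynomials: list of coefficients c₀ , c₁ , c₂ , …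
  UPoly : Set c
  UPoly = List Carrier

  embed : ∀ {m} → Fin m → UPoly → MPoly m
  embed i cs = go 0 cs
    where
    go : ℕ → UPoly → MPoly _
    go e []       = []
    go e (a ∷ as) = (a , xpow i e) ∷ go (ℕ.suc e) as

  Σₚ : ∀ {m} n → (Fin n → MPoly m) → MPoly m
  Σₚ n f = foldr (λ i acc → f i +ₚ acc) 0ₚ (allFin n)

  Πₚ : ∀ {m} n → (Fin n → MPoly m) → MPoly m
  Πₚ n f = foldr (λ i acc → f i *ₚ acc) 1ₚ (allFin n)

  -- Oblivious algebraic branching programs in m variables.
  --
  -- ABPFrom m a : the part of an ABP starting at a layer with a vertices
  -- (vertices Fin a).  Each 'layer' constructor is one layer of edges,
  -- going to the next vertex layer with b vertices; it reads a single
  -- variable x_v, and the label of the edge u → t is a univariate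
  -- polynomial in x_v (a missing edge is the label 0, i.e. []).
  -- 'done' marks the last vertex layer, which consists of the single sink.
  data ABPFrom (m : ℕ) : ℕ → Set c where
    done  : ABPFrom m 1
    layer : ∀ {a} b → (v : Fin m) → (Fin a → Fin b → UPoly) →
            ABPFrom m b → ABPFrom m a

  -- an ABP: layer 0 consists of the single source
  ABP : ℕ → Set c
  ABP m = ABPFrom m 1

  pathSum : ∀ {m a} → ABPFrom m a → Fin a → MPoly m
  pathSum done              _ = 1ₚ
  pathSum (layer b v M A) u = Σₚ b (λ t → embed v (M u t) *ₚ pathSum A t)

  computed : ∀ {m} → ABP m → MPoly m
  computed A = pathSum A Fin.zero

  Width≤ : ∀ {m a} → ABPFrom m a → ℕ → Set
  Width≤ {a = a} done            w = a ≤ w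
  Width≤ {a = a} (layer b v M A) w = a ≤ w × Width≤ A w

  reads : ∀ {m a} → ABPFrom m a → Fin m → ℕ
  reads done            i = 0
  reads (layer b v M A) i with v ≟ᶠ i
  ... | yes _ = ℕ.suc (reads A i)
  ... | no  _ = reads A i

  ReadK : ∀ {m a} → ABPFrom m a → ℕ → Set
  ReadK A k = ∀ i → reads A i ≤ k

  -- The polynomial Q_n in the 3n variables x₀…x_{n-1}, y₀…y_{n-1},
  -- z₀…z_{n-1} (0-based; variable order x, y, z).
  module _ (n : ℕ) .{{_ : NonZero n}} where
    X Y Z : Fin n → Fin (n ℕ.+ n ℕ.+ n)
    X j = (j ↑ˡ n) ↑ˡ n
    Y j = (n ↑ʳ j) ↑ˡ n
    Z i = (n ℕ.+ n) ↑ʳ i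

    -- 1-based:  Q_n = Σ_{i=1}^n z_i Π_{j=1}^n (x_j + y_{(j+i) mod n}),
    -- with y-indices in {1,…,n}.  With i = i'+1, j = j'+1 the 0-based
    -- index of y_{(j+i) mod n} is (j'+i'+1) mod n.
    Q : MPoly (n ℕ.+ n ℕ.+ n)
    Q = Σₚ n (λ i → var (Z i) *ₚ
          Πₚ n (λ j → var (X j) +ₚ
            var (Y ((Fin.toℕ j ℕ.+ Fin.toℕ i ℕ.+ 1) mod n))))

-- The theorem's conclusion, with the absolute constants d, C quantified
-- before all fields (hence a record in Setω).
--   w ≥ exp(n / k^{O(k)})   is rendered as   2^n ≤ w^(d · k^(C·k)).

record LowerBound : Setω where
  field
    d C   : ℕ
    bound : ∀ {c ℓ} (F : Field c ℓ) → let open Poly F in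
            (n : ℕ) .{{_ : NonZero n}} (k w : ℕ) (A : ABP (n ℕ.+ n ℕ.+ n)) →
            ReadK A k → Width≤ A w → computed A ≈ₚ Q n →
            2 ℕ.^ n ≤ w ℕ.^ (d ℕ.* k ℕ.^ (C ℕ.* k))

{-# OPTIONS --safe #-}

-- Alon–Maass: reading the sequence of layers from left to right until half of the
-- x-variables or half of the y-variables have occurred, keeping those of the one kind
-- that occurred and those of the other kind that did not, and repeating 2k times, leaves
-- U ⊆ x and V ⊆ y with |U|, |V| ≥ n / 4^k such that the layers reading U ∪ V form at most
-- 2k + 1 blocks, alternately free of V and of U. Averaging over the n cyclic shifts gives
-- an i for which s ≥ |U| |V| / n ≥ n / 16^k factors x_j + y_{j+i} have x_j ∈ U and
-- y_{j+i} ∈ V. Put z = e_i, give these x_j values in {0, 1} and these y_{j+i} values in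
-- {0, -1}, and let every other factor be 1. With rows and columns indexed by the
-- assignments to U and to V, the values of Q_n form a 2^s × 2^s diagonal matrix with
-- entries ±1, whereas the program factors it through w^(2k) dimensions. Hence
-- 2^s ≤ w^(2k), and 2k · 16^k ≤ 32 · k^(5k).
module Submission where

open import Defs
open import Level using (Level; _⊔_)
open import Data.Bool using (Bool; true; false; not)
open import Data.Fin using (Fin; zero; suc; toℕ; punchIn; punchOut; _↑ˡ_; _↑ʳ_; remQuot; combine; splitAt; finToFun; funToFin)
open import Data.Fin.Patterns using (0F; 1F)
open import Data.Fin.Properties
  using (_≟_; any?; punchInᵢ≢i; punchIn-punchOut; remQuot-combine; ¬∀⟶∃¬; splitAt-↑ˡ; splitAt-↑ʳ;
         splitAt⁻¹-↑ˡ; splitAt⁻¹-↑ʳ; ↑ˡ-injective; funToFin-finToFin)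
open import Data.List using (List; []; _∷_; [_]; length; map; filter; foldr; tabulate)
open import Data.List.Properties using (filter-notAll)
open import Data.List.Relation.Unary.Any using (here; there)
open import Data.Nat as ℕ using (ℕ; zero; suc; NonZero; z≤n; s≤s)
open import Data.Nat.DivMod using (_mod_)
import Data.Nat.Properties as ℕ
open import Data.Product using (Σ; _×_; _,_; ∃; proj₁; proj₂)
open import Data.Sum using (_⊎_; inj₁; inj₂)
open import Data.Vec using ([]; _∷_; replicate; zipWith)
open import Data.Vec.Properties using (≡-dec)
open import Function using (_∘_; flip)
open import Relation.Binary.PropositionalEquality as ≡ using (_≡_; _≢_)
open import Relation.Nullary using (¬_; Dec; yes; no; does; contradiction; ¬?)
open import Relation.Nullary.Decidable using (dec-true; dec-false; decidable-stable; ¬¬-excluded-middle)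
import Algebra.Properties.CommutativeMonoid.Sum
import Algebra.Properties.CommutativeSemigroup
import Algebra.Properties.Ring
import Algebra.Properties.Semiring.Exp
import Algebra.Properties.Semiring.Sum
import Relation.Binary.Reasoning.Setoid

module Combinatorics where

  open import Data.Bool using (_∧_; if_then_else_)
  import Data.Bool.Properties as Bool
  open import Data.Fin.Permutation using (Permutation; permutation; inverseˡ; _⟨$⟩ˡ_)
  open import Data.Fin.Properties using (toℕ<n; toℕ-fromℕ<; toℕ-injective; suc-injective)
  open import Data.List using (_++_)
  open import Data.List.Membership.DecPropositional using () renaming (_∈?_ to member?)
  open import Data.List.Membership.Propositional using (_∈_; _∉_)
  open import Data.List.Membership.Propositional.Properties
    using (∈-++⁻; ∈-++⁺ˡ; ∈-filter⁺; ∈-length)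
  open import Data.List.Properties using (++-assoc; ++-identityʳ; length-++; filter-++)
  open import Data.Nat using (_+_; _*_; _^_; _≤_; pred)
  open import Data.Nat.DivMod using (_%_; m%n<n; %-distribˡ-+; m%n%n≡m%n; [m+kn]%n≡m%n; m<n⇒m%n≡m)
  open import Data.Nat.Properties hiding (_≟_; suc-injective)
  open ≡ using (refl; sym; trans; cong; cong₂; subst; module ≡-Reasoning)
  open Algebra.Properties.Semiring.Sum +-*-semiring
    using (sum; sum-cong-≗; ∑-distrib-+; ∑-comm; sum-permute; *-distribˡ-sum; *-distribʳ-sum)

  -- Counting subsets of a finite index set.

  bit : Bool → ℕ
  bit b = if b then 1 else 0

  # : ∀ {n} → (Fin n → Bool) → ℕ
  # S = sum (bit ∘ S)

  #-cong : ∀ {n} {S T : Fin n → Bool} → (∀ j → S j ≡ T j) → # S ≡ # T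
  #-cong S≡T = sum-cong-≗ (cong bit ∘ S≡T)

  #-full : ∀ n → # {n} (λ _ → true) ≡ n
  #-full zero    = refl
  #-full (suc n) = cong suc (#-full n)

  #-split : ∀ {n} (S T : Fin n → Bool) →
            # (λ j → S j ∧ T j) + # (λ j → S j ∧ not (T j)) ≡ # S
  #-split S T = trans (sym (∑-distrib-+ (λ j → bit (S j ∧ T j)) (λ j → bit (S j ∧ not (T j)))))
    (sum-cong-≗ λ j → bit-split (S j) (T j))
    where
    bit-split : ∀ x y → bit (x ∧ y) + bit (x ∧ not y) ≡ bit x
    bit-split false _     = refl
    bit-split true  false = refl
    bit-split true  true  = refl

  ∧-conj : ∀ {x y} → x ∧ y ≡ true → x ≡ true × y ≡ true
  ∧-conj {true} {true} _ = refl , refl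

  either-side : ∀ {P : Bool → Set} s → P s → P (not s) → ∀ r → P r
  either-side true  p q true  = p
  either-side true  p q false = q
  either-side false p q true  = q
  either-side false p q false = p

  -- Alternating blocks of the two kinds of symbols in a read sequence.

  module Alternation {m n : ℕ} (e : Bool → Fin n → Fin m)
                     (disjoint : ∀ i j → e true i ≢ e false j) where

    Family : Set
    Family = Bool → Fin n → Bool

    _⊆_ : Family → Family → Set
    V ⊆ W = ∀ r j → V r j ≡ true → W r j ≡ true

    Avoids : (Fin n → Bool) → Bool → List (Fin m) → Set
    Avoids S r l = ∀ j → S j ≡ true → e r j ∉ l

    occurrences : Fin m → List (Fin m) → ℕ
    occurrences v l = length (filter (_≟ v) l)

    -- Alt W s t l: l is a concatenation of at most t + 1 blocks, alternately free
    -- of W (not s)-symbols and of W s-symbols.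
    data Alt (W : Family) : Bool → ℕ → List (Fin m) → Set where
      nil    : ∀ {s} → Alt W s 0 []
      read   : ∀ {s t v l} → Avoids (W (not s)) (not s) [ v ] →
               Alt W s t l → Alt W s t (v ∷ l)
      switch : ∀ {s t l} → Alt W (not s) t l → Alt W s (suc t) l

    alt-++ : ∀ {W s t l} p → Avoids (W (not s)) (not s) p →
             Alt W s t l → Alt W s t (p ++ l)
    alt-++ []      _ A = A
    alt-++ (v ∷ p) a A =
      read (λ { j w (here eq) → a j w (here eq) })
           (alt-++ p (λ j w → a j w ∘ there) A)

    alt-avoids : ∀ {W} s l → Avoids (W (not s)) (not s) l → Alt W s 0 l
    alt-avoids {W} s l a = subst (Alt W s 0) (++-identityʳ l) (alt-++ l a nil)

    _∈?_ : (v : Fin m) (l : List (Fin m)) → Dec (v ∈ l)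
    _∈?_ = member? _≟_

    seen unseen : (Fin n → Bool) → Bool → List (Fin m) → Fin n → Bool
    seen   S r p j = S j ∧ does (e r j ∈? p)
    unseen S r p j = S j ∧ not (does (e r j ∈? p))

    seen-∈ : ∀ S r p j → seen S r p j ≡ true → S j ≡ true × e r j ∈ p
    seen-∈ S r p j eq with S j | e r j ∈? p
    ... | true | yes i = refl , i

    unseen-∉ : ∀ S r p j → unseen S r p j ≡ true → S j ≡ true × e r j ∉ p
    unseen-∉ S r p j eq with S j | e r j ∈? p
    ... | true | no i = refl , i

    Sparse : Family → Bool → List (Fin m) → Set
    Sparse W r p = 2 * # (seen (W r) r p) ≤ # (W r)

    2[m+n] : ∀ x y → x + y + (x + y) ≡ 2 * x + 2 * y
    2[m+n] x y = trans (cong (x + y +_) (sym (+-identityʳ (x + y)))) (*-distribˡ-+ 2 x y)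

    unseen-half : ∀ W r p → Sparse W r p → # (W r) ≤ 2 * # (unseen (W r) r p)
    unseen-half W r p h = +-cancelˡ-≤ (# (W r)) _ _ (begin
      # (W r) + # (W r)    ≡⟨ cong₂ _+_ (sym split) (sym split) ⟩
      x + y + (x + y)      ≡⟨ 2[m+n] x y ⟩
      2 * x + 2 * y        ≤⟨ +-monoˡ-≤ (2 * y) h ⟩
      # (W r) + 2 * y      ∎)
      where
      open ≤-Reasoning
      x = # (seen (W r) r p)
      y = # (unseen (W r) r p)
      split = #-split (W r) (λ j → does (e r j ∈? p))

    -- In the `stop` outcome every kept `s`-symbol has spent an occurrence in `p`, so fewer remain
    -- in `q`, while no kept symbol of the other kind occurs in `p`; this makes `p` a single block.
    data Scan (W : Family) (l : List (Fin m)) : Set where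
      exhausted : ∀ V → V ⊆ W → (∀ r → # (W r) ≤ 2 * # (V r)) →
                  (∀ r → Avoids (V r) r l) → Scan W l
      stop      : ∀ V → V ⊆ W → (∀ r → # (W r) ≤ 2 * # (V r)) →
                  ∀ s p q → l ≡ p ++ q → (∀ j → V s j ≡ true → e s j ∈ p) →
                  Avoids (V (not s)) (not s) p → Scan W l

    -- Only the exclusion of one kind is recorded, since `v` may belong to neither, as the
    -- z-variables do; then either side would serve.
    kind : ∀ v → ∃ λ s → ∀ j → e (not s) j ≢ v
    kind v with any? (λ j → e true j ≟ v)
    ... | yes (i , refl) = true , λ j eq → disjoint i j (sym eq)
    ... | no  ∄          = false , λ j eq → ∄ (j , eq)

    -- A symbol that is not of kind `r` leaves the set of seen `r`-symbols, and so its size, as it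
    -- was.
    sparse-snoc : ∀ W r p v → (∀ j → e r j ≢ v) → Sparse W r p → Sparse W r (p ++ [ v ])
    sparse-snoc W r p v ≢v = subst (λ x → 2 * x ≤ # (W r))
                               (#-cong λ j → cong (W r j ∧_) (same j))
      where
      same : ∀ j → does (e r j ∈? p) ≡ does (e r j ∈? (p ++ [ v ]))
      same j with e r j ∈? p
      ... | yes i = sym (dec-true (e r j ∈? (p ++ [ v ])) (∈-++⁺ˡ i))
      ... | no ∉p = sym (dec-false (e r j ∈? (p ++ [ v ])) λ i → new (∈-++⁻ p i))
        where
        new : ¬ (e r j ∈ p ⊎ e r j ∈ [ v ])
        new (inj₁ i)         = ∉p i
        new (inj₂ (here eq)) = ≢v j eq

    -- Stop as soon as more than half of the W s-symbols have been read, for either s. Only one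
    -- of the two counts moves at each step, so the other one is still at most half.
    scan : ∀ W p q → (∀ r → Sparse W r p) → Scan W (p ++ q)
    scan W p [] sparse =
      exhausted (λ r → unseen (W r) r p) (λ r j → proj₁ ∘ unseen-∉ (W r) r p j)
        (λ r → unseen-half W r p (sparse r))
        (λ r j u i → proj₂ (unseen-∉ (W r) r p j u) (subst (e r j ∈_) (++-identityʳ p) i))
    scan W p (v ∷ q) sparse with kind v
    ... | s , ≢v = subst (Scan W) (++-assoc p [ v ] q) (step s ≢v)
      where
      p′ = p ++ [ v ]
      other : ∀ s → (∀ j → e (not s) j ≢ v) → Sparse W (not s) p′
      other s ≢v = sparse-snoc W (not s) p v ≢v (sparse (not s))
      V : Bool → Family
      V s r = if does (r Bool.≟ s) then seen (W r) r p′ else unseen (W r) r p′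
      Halved : Bool → Bool → Set
      Halved s r = # (W r) ≤ 2 * # (V s r)
      V⊆W : ∀ s → V s ⊆ W
      V⊆W s r j with does (r Bool.≟ s)
      ... | true  = proj₁ ∘ seen-∈ (W r) r p′ j
      ... | false = proj₁ ∘ unseen-∉ (W r) r p′ j
      step : ∀ s → (∀ j → e (not s) j ≢ v) → Scan W (p′ ++ q)
      step s ≢v with 2 * # (seen (W s) s p′) ℕ.≤? # (W s)
      ... | yes ≤½ = scan W p′ q (either-side {P = λ r → Sparse W r p′} s ≤½ (other s ≢v))
      -- Both cases are the same argument; fixing `s` lets the conditionals in `V` compute.
      step true ≢v | no ≰½ =
        stop (V true) (V⊆W true)
          (either-side {P = Halved true} true (<⇒≤ (≰⇒> ≰½)) (unseen-half W false p′ (other true ≢v)))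
          true p′ q refl (λ j → proj₂ ∘ seen-∈ (W true) true p′ j)
          (λ j → proj₂ ∘ unseen-∉ (W false) false p′ j)
      step false ≢v | no ≰½ =
        stop (V false) (V⊆W false)
          (either-side {P = Halved false} false (<⇒≤ (≰⇒> ≰½)) (unseen-half W true p′ (other false ≢v)))
          false p′ q refl (λ j → proj₂ ∘ seen-∈ (W false) false p′ j)
          (λ j → proj₂ ∘ unseen-∉ (W true) true p′ j)

    occurrences-++ : ∀ v p q → occurrences v (p ++ q) ≡ occurrences v p + occurrences v q
    occurrences-++ v p q = trans (cong length (filter-++ (_≟ v) p q)) (length-++ (filter (_≟ v) p))

    ∈⇒occurrences : ∀ {v l} → v ∈ l → 1 ≤ occurrences v l
    ∈⇒occurrences i = ∈-length (∈-filter⁺ (_≟ _) i refl)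

    unread : ∀ {v l} → occurrences v l ≤ 0 → v ∉ l
    unread h i = contradiction (≤-trans (∈⇒occurrences i) h) λ ()

    record Subfamily (W : Family) (N : ℕ) (l : List (Fin m)) : Set where
      field
        V     : Family
        V⊆W   : V ⊆ W
        large : ∀ r → # (W r) ≤ 2 ^ N * # (V r)
        side  : Bool
        t     : ℕ
        t≤N   : t ≤ N
        alt   : Alt V side t l

    -- Induction on `N`, which bounds the joint occurrences of one kept symbol of each kind. A scan
    -- keeps at least half of each set. If it stops, every kept pair has lost an occurrence to `p`,
    -- so `N` drops by one while `p` costs at most one more alternation. At `N = 0`, either the
    -- first set is empty or, paired with one of its members, no symbol of the second set occurs at
    -- all.
    few-alternations : ∀ N W l →
      (∀ i j → W true i ≡ true → W false j ≡ true →
        occurrences (e true i) l + occurrences (e false j) l ≤ N) →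
      Subfamily W N l
    few-alternations zero W l occ = record
      { V = W ; V⊆W = λ _ _ w → w ; large = λ r → ≤-reflexive (sym (+-identityʳ _))
      ; side = proj₁ free ; t = 0 ; t≤N = z≤n ; alt = proj₂ free }
      where
      free : ∃ λ s → Alt W s 0 l
      free with any? (λ i → W true i Bool.≟ true)
      ... | yes (i , w) = true , alt-avoids true l λ j w′ → unread (m+n≤o⇒n≤o _ (occ i j w w′))
      ... | no ∄        = false , alt-avoids false l λ j w → contradiction (j , w) ∄
    few-alternations (suc N) W l occ with scan W [] l (λ r → ≤-trans (≤-reflexive (cong (2 *_) (none r))) z≤n)
      where
      none : ∀ r → # (seen (W r) r []) ≡ 0
      none r = trans (#-cong λ j → Bool.∧-zeroʳ (W r j)) (zeros n)
        where
        zeros : ∀ n → # {n} (λ _ → false) ≡ 0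
        zeros zero    = refl
        zeros (suc n) = zeros n
    ... | exhausted V V⊆W half avoids = record
      { V = V ; V⊆W = V⊆W
      ; large = λ r → ≤-trans (half r) (*-monoˡ-≤ (# (V r)) (m≤m*n 2 (2 ^ N) {{m^n≢0 2 N}}))
      ; side = true ; t = 0 ; t≤N = z≤n ; alt = alt-avoids true l (avoids false) }
    ... | stop V V⊆W half s p q refl inp avoids = record
      { V = R.V ; V⊆W = λ r j → V⊆W r j ∘ R.V⊆W r j
      ; large = λ r → begin
          # (W r)                   ≤⟨ half r ⟩
          2 * # (V r)               ≤⟨ *-monoʳ-≤ 2 (R.large r) ⟩
          2 * (2 ^ N * # (R.V r))   ≡⟨ *-assoc 2 (2 ^ N) _ ⟨
          2 ^ suc N * # (R.V r)     ∎
      ; side = s ; t = proj₁ joined ; t≤N = proj₁ (proj₂ joined)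
      ; alt = alt-++ p (λ j → avoids j ∘ R.V⊆W (not s) j) (proj₂ (proj₂ joined)) }
      where
      open ≤-Reasoning
      occ-q : ∀ v → occurrences v q ≤ occurrences v (p ++ q)
      occ-q v = ≤-trans (m≤n+m _ _) (≤-reflexive (sym (occurrences-++ v p q)))
      occ-p : ∀ {v} → v ∈ p → suc (occurrences v q) ≤ occurrences v (p ++ q)
      occ-p {v} i = ≤-trans (+-monoˡ-≤ _ (∈⇒occurrences i)) (≤-reflexive (sym (occurrences-++ v p q)))
      -- Each pair contains exactly one `s`-symbol, and that symbol occurs in `p`.
      drop : ∀ s → (∀ j → V s j ≡ true → e s j ∈ p) → ∀ i j → V true i ≡ true → V false j ≡ true →
             suc (occurrences (e true i) q + occurrences (e false j) q) ≤
             occurrences (e true i) (p ++ q) + occurrences (e false j) (p ++ q)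
      drop true  inp i j v v′ = +-mono-≤ (occ-p (inp i v)) (occ-q _)
      drop false inp i j v v′ =
        ≤-trans (≤-reflexive (sym (+-suc _ _))) (+-mono-≤ (occ-q _) (occ-p (inp j v′)))
      module R = Subfamily (few-alternations N V q λ i j v v′ →
        ℕ.s≤s⁻¹ (≤-trans (drop s inp i j v v′) (occ i j (V⊆W true i v) (V⊆W false j v′))))
      -- `p` is a block on side `s`. If the decomposition of `q` starts on the same side, `p` merges
      -- into its first block; otherwise one `switch` is inserted.
      joined : ∃ λ t → t ≤ suc N × Alt R.V s t q
      joined with R.side Bool.≟ s
      ... | yes eq = R.t , m≤n⇒m≤1+n R.t≤N , subst (λ r → Alt R.V r R.t q) eq R.alt
      ... | no ≢s  = suc R.t , s≤s R.t≤N ,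
                     switch (subst (λ r → Alt R.V r R.t q) (Bool.¬-not ≢s) R.alt)

  -- Cyclic shifts and the number of matches between two subsets.

  module _ (n : ℕ) .{{_ : NonZero n}} where

    rot : ℕ → Fin n → Fin n
    rot c i = (toℕ i + c) mod n

    rot-rot : ∀ k c d → c + d ≡ k * n → ∀ i → rot d (rot c i) ≡ i
    rot-rot k c d c+d i = toℕ-injective (begin
      toℕ (rot d (rot c i))                ≡⟨ toℕ-rot d (rot c i) ⟩
      (toℕ (rot c i) + d) % n              ≡⟨ cong (λ x → (x + d) % n) (toℕ-rot c i) ⟩
      ((toℕ i + c) % n + d) % n            ≡⟨ %-distribˡ-+ ((toℕ i + c) % n) d n ⟩
      ((toℕ i + c) % n % n + d % n) % n    ≡⟨ cong (λ x → (x + d % n) % n) (m%n%n≡m%n (toℕ i + c) n) ⟩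
      ((toℕ i + c) % n + d % n) % n        ≡⟨ %-distribˡ-+ (toℕ i + c) d n ⟨
      (toℕ i + c + d) % n                  ≡⟨ cong (_% n) (trans (+-assoc (toℕ i) c d) (cong (toℕ i +_) c+d)) ⟩
      (toℕ i + k * n) % n                  ≡⟨ [m+kn]%n≡m%n (toℕ i) k n ⟩
      toℕ i % n                            ≡⟨ m<n⇒m%n≡m (toℕ<n i) ⟩
      toℕ i                                ∎)
      where
      open ≡-Reasoning
      toℕ-rot : ∀ c i → toℕ (rot c i) ≡ (toℕ i + c) % n
      toℕ-rot c i = toℕ-fromℕ< (m%n<n (toℕ i + c) n)

    -- The inverse shift is taken to be `c * pred n`, since c + c(n - 1) = cn; this holds for every
    -- `c`, without subtraction or a comparison with `n`.
    rotation : ℕ → Permutation n n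
    rotation c = permutation (rot c) (rot (c * pred n))
      (rot-rot c (c * pred n) c (trans (+-comm _ c) c+c′))
      (rot-rot c c (c * pred n) c+c′)
      where
      c+c′ : c + c * pred n ≡ c * n
      c+c′ = trans (sym (*-suc c (pred n))) (cong (c *_) (suc-pred n))

    rot-injective : ∀ c {i j} → rot c i ≡ rot c j → i ≡ j
    rot-injective c {i} {j} eq =
      trans (sym (inverseˡ (rotation c))) (trans (cong (rotation c ⟨$⟩ˡ_) eq) (inverseˡ (rotation c)))

    matches : (Fin n → Bool) → (Fin n → Bool) → ℕ → Fin n → Bool
    matches U V c j = U j ∧ V (rot c j)

    -- Double counting. Index j shifted by i + 1 is index i shifted by j + 1, so for fixed j the
    -- inner sum over i runs through `V` along a permutation and contributes `# V` exactly when j is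
    -- in `U`.
    matches-total : ∀ U V → sum {n} (λ i → # (matches U V (toℕ i + 1))) ≡ # U * # V
    matches-total U V = begin
      sum {n} (λ i → # (matches U V (toℕ i + 1)))
        ≡⟨ ∑-comm {n} {n} (λ i j → bit (U j ∧ V (rot (toℕ i + 1) j))) ⟩
      sum {n} (λ j → sum {n} λ i → bit (U j ∧ V (rot (toℕ i + 1) j)))
        ≡⟨ sum-cong-≗ {n} (λ j → trans (sum-cong-≗ {n} (term j))
             (sym (*-distribˡ-sum {n} (bit (U j)) λ i → bit (V (rot (toℕ j + 1) i))))) ⟩
      sum {n} (λ j → bit (U j) * sum {n} (λ i → bit (V (rot (toℕ j + 1) i))))
        ≡⟨ sum-cong-≗ {n} (λ j → cong (bit (U j) *_) (sum-permute {n} {n} (bit ∘ V) (rotation (toℕ j + 1)))) ⟨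
      sum {n} (λ j → bit (U j) * # V)
        ≡⟨ *-distribʳ-sum {n} (# V) (bit ∘ U) ⟨
      # U * # V ∎
      where
      open ≡-Reasoning
      bit-∧ : ∀ x y → bit (x ∧ y) ≡ bit x * bit y
      bit-∧ false _ = refl
      bit-∧ true  y = sym (+-identityʳ (bit y))
      shift : ∀ i j → rot (toℕ i + 1) j ≡ rot (toℕ j + 1) i
      shift i j = cong (_mod n) (begin
        toℕ j + (toℕ i + 1)   ≡⟨ +-assoc (toℕ j) (toℕ i) 1 ⟨
        toℕ j + toℕ i + 1     ≡⟨ cong (_+ 1) (+-comm (toℕ j) (toℕ i)) ⟩
        toℕ i + toℕ j + 1     ≡⟨ +-assoc (toℕ i) (toℕ j) 1 ⟩
        toℕ i + (toℕ j + 1)   ∎)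
      term : ∀ j i → bit (U j ∧ V (rot (toℕ i + 1) j)) ≡ bit (U j) * bit (V (rot (toℕ j + 1) i))
      term j i = trans (bit-∧ (U j) _) (cong (λ k → bit (U j) * bit (V k)) (shift i j))

  -- Averaging, and enumeration of a subset.

  above-average : ∀ n .{{_ : NonZero n}} (f : Fin n → ℕ) → ∃ λ i → sum {n} f ≤ n * f i
  above-average (suc zero)    f = zero , ≤-refl
  above-average (suc (suc n)) f with above-average (suc n) (f ∘ suc)
  ... | i , avg with ≤-total (f zero) (f (suc i))
  ... | inj₁ ≤fi = suc i , +-mono-≤ ≤fi avg
  ... | inj₂ fi≤ = zero , +-monoʳ-≤ (f zero) (≤-trans avg (*-monoʳ-≤ (suc n) fi≤))

  elements : ∀ {n} (S : Fin n → Bool) → Fin (# S) → Fin n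
  elements {suc n} S i with S zero
  elements {suc n} S zero    | true  = zero
  elements {suc n} S (suc i) | true  = suc (elements (S ∘ suc) i)
  elements {suc n} S i       | false = suc (elements (S ∘ suc) i)

  elements-∈ : ∀ {n} (S : Fin n → Bool) i → S (elements S i) ≡ true
  elements-∈ {suc n} S i with S zero in eq
  elements-∈ {suc n} S zero    | true  = eq
  elements-∈ {suc n} S (suc i) | true  = elements-∈ (S ∘ suc) i
  elements-∈ {suc n} S i       | false = elements-∈ (S ∘ suc) i

  elements-injective : ∀ {n} (S : Fin n → Bool) {i j} → elements S i ≡ elements S j → i ≡ j
  elements-injective {suc n} S {i} {j} eq with S zero
  elements-injective {suc n} S {zero}  {zero}  eq | true  = refl
  elements-injective {suc n} S {suc i} {suc j} eq | true  = cong suc (elements-injective (S ∘ suc) (suc-injective eq))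
  elements-injective {suc n} S {i}     {j}     eq | false = elements-injective (S ∘ suc) (suc-injective eq)

  -- Numerical estimates for the exponent.

  2m≤2^m : ∀ m → 2 * m ≤ 2 ^ m
  2m≤2^m zero          = z≤n
  2m≤2^m (suc zero)    = ≤-refl
  2m≤2^m (suc (suc m)) = begin
    2 * suc (suc m)        ≡⟨ *-suc 2 (suc m) ⟩
    2 + 2 * suc m          ≤⟨ +-mono-≤ (m≤m*n 2 (suc m)) (≤-refl {2 * suc m}) ⟩
    2 * suc m + 2 * suc m  ≤⟨ +-mono-≤ (2m≤2^m (suc m)) (2m≤2^m (suc m)) ⟩
    2 ^ suc m + 2 ^ suc m  ≡⟨ cong (2 ^ suc m +_) (+-identityʳ _) ⟨
    2 ^ suc (suc m)        ∎
    where open ≤-Reasoning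

  -- For k ≥ 2 the left side is at most 2^k · 16^k = 2^(5k) ≤ k^(5k), whence the constant 5. The
  -- base k is useless at k = 1, where the left side is 32, whence the constant 32.
  exponent-bound : ∀ k → 2 * k * (2 ^ (2 * k) * 2 ^ (2 * k)) ≤ 32 * k ^ (5 * k)
  exponent-bound zero       = z≤n
  exponent-bound (suc zero) = ℕ.≤ᵇ⇒≤ 32 32 _
  exponent-bound k@(suc (suc _)) = begin
    2 * k * (2 ^ (2 * k) * 2 ^ (2 * k))     ≤⟨ *-monoˡ-≤ _ (2m≤2^m k) ⟩
    2 ^ k * (2 ^ (2 * k) * 2 ^ (2 * k))     ≡⟨ cong (2 ^ k *_) (^-distribˡ-+-* 2 (2 * k) (2 * k)) ⟨
    2 ^ k * 2 ^ (2 * k + 2 * k)             ≡⟨ ^-distribˡ-+-* 2 k (2 * k + 2 * k) ⟨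
    2 ^ (k + (2 * k + 2 * k))               ≡⟨ cong (2 ^_) (cong (k +_) (*-distribʳ-+ k 2 2)) ⟨
    2 ^ (5 * k)                             ≤⟨ ^-monoˡ-≤ (5 * k) (s≤s (s≤s z≤n)) ⟩
    k ^ (5 * k)                             ≤⟨ m≤n*m (k ^ (5 * k)) 32 ⟩
    32 * k ^ (5 * k)                        ∎
    where open ≤-Reasoning

  -- Here u and v are the sizes of the two kept sets, s the number of matched factors and t the
  -- number of alternations. From n² ≤ c²uv ≤ c²ns follows n ≤ sc², so raising 2^s ≤ w^t to the
  -- power c² gives the bound.
  power-bound : ∀ n c u v s w t k .{{_ : NonZero n}} .{{_ : NonZero w}} →
    n ≤ c * u → n ≤ c * v → u * v ≤ n * s → 2 ^ s ≤ w ^ t → t ≤ 2 * k → c ≡ 2 ^ (2 * k) →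
    2 ^ n ≤ w ^ (32 * k ^ (5 * k))
  power-bound n c u v s w t k n≤cu n≤cv uv≤ns 2^s≤w^t t≤2k refl = begin
    2 ^ n                 ≤⟨ ^-monoʳ-≤ 2 n≤s*cc ⟩
    2 ^ (s * (c * c))     ≡⟨ ^-*-assoc 2 s (c * c) ⟨
    (2 ^ s) ^ (c * c)     ≤⟨ ^-monoˡ-≤ (c * c) 2^s≤w^t ⟩
    (w ^ t) ^ (c * c)     ≡⟨ ^-*-assoc w t (c * c) ⟩
    w ^ (t * (c * c))     ≤⟨ ^-monoʳ-≤ w (≤-trans (*-monoˡ-≤ (c * c) t≤2k) (exponent-bound k)) ⟩
    w ^ (32 * k ^ (5 * k)) ∎
    where
    open ≤-Reasoning
    n≤s*cc : n ≤ s * (c * c)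
    n≤s*cc = *-cancelˡ-≤ n (begin
      n * n                 ≤⟨ *-mono-≤ n≤cu n≤cv ⟩
      c * u * (c * v)       ≡⟨ [m*n]*[o*p]≡[m*o]*[n*p] c u c v ⟩
      c * c * (u * v)       ≤⟨ *-monoʳ-≤ (c * c) uv≤ns ⟩
      c * c * (n * s)       ≡⟨ *-comm (c * c) (n * s) ⟩
      n * s * (c * c)       ≡⟨ *-assoc n s (c * c) ⟩
      n * (s * (c * c))     ∎)

open Combinatorics

-- Linear dependence and the rank of a diagonal matrix.

module LinearAlgebra {c ℓ : Level} (F : Field c ℓ) where
  open Field F hiding (zero)
  open Algebra.Properties.Semiring.Sum semiring
    using (sum; sum-cong-≋; sum-replicate-zero; sum-remove; ∑-distrib-+; ∑-comm; *-distribˡ-sum; *-distribʳ-sum)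
  open Algebra.Properties.Ring ring using (-‿distribʳ-*; -‿distribˡ-*)
  open Relation.Binary.Reasoning.Setoid setoid

  nonzero-* : ∀ {x y} → ¬ x ≈ 0# → ¬ y ≈ 0# → ¬ x * y ≈ 0#
  nonzero-* {x} {y} x≉0 y≉0 xy≈0 with inverse y y≉0
  ... | y⁻¹ , yy⁻¹≈1 = x≉0 (begin
    x              ≈⟨ *-identityʳ x ⟨
    x * 1#         ≈⟨ *-congˡ yy⁻¹≈1 ⟨
    x * (y * y⁻¹)  ≈⟨ *-assoc x y y⁻¹ ⟨
    x * y * y⁻¹    ≈⟨ *-congʳ xy≈0 ⟩
    0# * y⁻¹       ≈⟨ zeroˡ y⁻¹ ⟩
    0#             ∎)

  sum-zero : ∀ n {f : Fin n → Carrier} → (∀ i → f i ≈ 0#) → sum {n} f ≈ 0#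
  sum-zero n f≈0 = trans (sum-cong-≋ {n} f≈0) (sum-replicate-zero n)

  sum-single : ∀ n {f : Fin n → Carrier} i → (∀ j → j ≢ i → f j ≈ 0#) → sum {n} f ≈ f i
  sum-single (suc n) {f} i f≈0 =
    trans (sum-remove {n} {i} f)
      (trans (+-congˡ (sum-zero n λ j → f≈0 (punchIn i j) (punchInᵢ≢i i j))) (+-identityʳ (f i)))

  -- Excluded middle for a single proposition holds under double negation, and finitely many
  -- instances can be chained. It serves to search a row for a nonzero pivot.
  ¬¬-all-or-counterexample : ∀ {r p} (P : Fin r → Set p) → ¬ ¬ ((∃ λ k → ¬ P k) ⊎ (∀ k → P k))
  ¬¬-all-or-counterexample {zero}  P κ = κ (inj₂ λ ())
  ¬¬-all-or-counterexample {suc r} P κ = ¬¬-excluded-middle λ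
    { (no ¬p) → κ (inj₁ (zero , ¬p))
    ; (yes p) → ¬¬-all-or-counterexample (P ∘ suc) λ
        { (inj₁ (k , ¬p)) → κ (inj₁ (suc k , ¬p))
        ; (inj₂ q)        → κ (inj₂ λ { zero → p ; (suc k) → q k }) } }

  Dependent : ∀ {r} N → (Fin N → Fin r → Carrier) → Set _
  Dependent N f = Σ (Fin N → Carrier) λ v →
    (∃ λ i → ¬ v i ≈ 0#) × (∀ k → sum {N} (λ i → v i * f i k) ≈ 0#)

  zero-row : ∀ {r N} (f : Fin (suc N) → Fin r → Carrier) → (∀ k → f zero k ≈ 0#) → Dependent (suc N) f
  zero-row {r} {N} f z = v , (zero , 1≉0) , λ k → begin
    1# * f zero k + sum {N} (λ i → 0# * f (suc i) k)  ≈⟨ +-cong (trans (*-identityˡ _) (z k)) (sum-zero N λ i → zeroˡ _) ⟩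
    0# + 0#                                          ≈⟨ +-identityˡ 0# ⟩
    0#                                               ∎
    where
    v : Fin (suc N) → Carrier
    v zero    = 1#
    v (suc _) = 0#

  -- One step of Gaussian elimination: the pivot is the entry of row `zero` in column `k`, `p⁻¹` is
  -- its inverse, and the pivot row and column are dropped.
  reduced : ∀ {r N} (f : Fin (suc N) → Fin (suc r) → Carrier) (k : Fin (suc r)) → Carrier →
            Fin N → Fin r → Carrier
  reduced f k p⁻¹ i j = f (suc i) (punchIn k j) - f (suc i) k * p⁻¹ * f zero (punchIn k j)

  -- A relation among the reduced rows lifts by giving row `zero` the coefficient that collects all
  -- subtracted multiples. Column `k` then vanishes entry by entry, and the other columns are those
  -- of the reduced matrix. The old coefficients are kept, so the relation stays nontrivial.
  eliminate : ∀ {r N} (f : Fin (suc N) → Fin (suc r) → Carrier) k p⁻¹ → f zero k * p⁻¹ ≈ 1# →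
              Dependent N (reduced f k p⁻¹) → Dependent (suc N) f
  eliminate {r} {N} f k p⁻¹ inv (v , (i , vi≉0) , dep) = v′ , (suc i , vi≉0) , column
    where
    q : Fin N → Carrier
    q i = f (suc i) k * p⁻¹
    v′ : Fin (suc N) → Carrier
    v′ zero    = - sum {N} (λ i → v i * q i)
    v′ (suc i) = v i
    row-sum : ∀ l → sum {suc N} (λ i → v′ i * f i l) ≈ sum {N} (λ i → v i * (f (suc i) l - q i * f zero l))
    row-sum l = begin
      v′ zero * f zero l + sum {N} (λ i → v i * f (suc i) l)
        ≈⟨ +-comm _ _ ⟩
      sum {N} (λ i → v i * f (suc i) l) + v′ zero * f zero l
        ≈⟨ +-congˡ (trans (sym (-‿distribˡ-* _ _)) (-‿distribʳ-* _ _)) ⟩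
      sum {N} (λ i → v i * f (suc i) l) + sum {N} (λ i → v i * q i) * (- f zero l)
        ≈⟨ +-congˡ (*-distribʳ-sum {N} (- f zero l) (λ i → v i * q i)) ⟩
      sum {N} (λ i → v i * f (suc i) l) + sum {N} (λ i → v i * q i * (- f zero l))
        ≈⟨ ∑-distrib-+ {N} _ _ ⟨
      sum {N} (λ i → v i * f (suc i) l + v i * q i * (- f zero l))
        ≈⟨ sum-cong-≋ {N} (λ i → trans (+-congˡ (trans (*-assoc _ _ _) (*-congˡ (sym (-‿distribʳ-* _ _)))))
                                       (sym (distribˡ _ _ _))) ⟩
      sum {N} (λ i → v i * (f (suc i) l - q i * f zero l)) ∎
    pivot : ∀ i → v i * (f (suc i) k - q i * f zero k) ≈ 0#
    pivot i = trans (*-congˡ (begin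
      f (suc i) k - f (suc i) k * p⁻¹ * f zero k    ≈⟨ +-congˡ (-‿cong (*-assoc _ _ _)) ⟩
      f (suc i) k - f (suc i) k * (p⁻¹ * f zero k)  ≈⟨ +-congˡ (-‿cong (*-congˡ (trans (*-comm _ _) inv))) ⟩
      f (suc i) k - f (suc i) k * 1#                ≈⟨ +-congˡ (-‿cong (*-identityʳ _)) ⟩
      f (suc i) k - f (suc i) k                     ≈⟨ -‿inverseʳ _ ⟩
      0#                                            ∎)) (zeroʳ (v i))
    column : ∀ l → sum {suc N} (λ i → v′ i * f i l) ≈ 0#
    column l with k ≟ l
    ... | yes ≡.refl = trans (row-sum k) (sum-zero N pivot)
    ... | no k≢l    = trans (row-sum l) (≡.subst (λ l → sum {N} (λ i → v i * (f (suc i) l - q i * f zero l)) ≈ 0#)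
                                          (punchIn-punchOut k≢l) (dep (punchOut k≢l)))

  -- Equality in F need not be decidable, hence the double negation.
  dependence : ∀ {r N} → r ℕ.< N → (f : Fin N → Fin r → Carrier) → ¬ ¬ Dependent N f
  dependence {zero}  {suc N} _         f κ = κ (zero-row f λ ())
  dependence {suc r} {suc N} (s≤s r<N) f κ = ¬¬-all-or-counterexample (λ k → f zero k ≈ 0#) λ
    { (inj₁ (k , p≉0)) → let p⁻¹ , inv = inverse (f zero k) p≉0 in
        dependence r<N (reduced f k p⁻¹) (κ ∘ eliminate f k p⁻¹ inv)
    ; (inj₂ z)         → κ (zero-row f z) }

  -- If r < N, some nonzero v satisfies v f = 0, hence v D = 0; but entry i of v D is `v i * D i i`,
  -- which is nonzero when `v i` is. The double negation in `dependence` does no harm, because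
  -- comparison of naturals is decidable.
  diagonal-rank : ∀ {N r} (D : Fin N → Fin N → Carrier) (f : Fin N → Fin r → Carrier) (g : Fin r → Fin N → Carrier) →
                  (∀ i j → D i j ≈ sum {r} (λ k → f i k * g k j)) →
                  (∀ i → ¬ D i i ≈ 0#) → (∀ i j → i ≢ j → D i j ≈ 0#) → N ℕ.≤ r
  diagonal-rank {N} {r} D f g D≈fg D≉0 D≈0 = decidable-stable (N ℕ.≤? r) λ N≰r →
    dependence (ℕ.≰⇒> N≰r) f λ { (v , (i , vi≉0) , dep) → nonzero-* vi≉0 (D≉0 i) (begin
      v i * D i i
        ≈⟨ sum-single N i (λ j j≢i → trans (*-congˡ (D≈0 j i j≢i)) (zeroʳ (v j))) ⟨
      sum {N} (λ j → v j * D j i)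
        ≈⟨ sum-cong-≋ {N} (λ j → trans (*-congˡ (D≈fg j i)) (trans (*-distribˡ-sum {r} (v j) (λ k → f j k * g k i))
             (sum-cong-≋ {r} λ k → sym (*-assoc _ _ _)))) ⟩
      sum {N} (λ j → sum {r} (λ k → v j * f j k * g k i))
        ≈⟨ ∑-comm {N} {r} (λ j k → v j * f j k * g k i) ⟩
      sum {r} (λ k → sum {N} (λ j → v j * f j k * g k i))
        ≈⟨ sum-zero r (λ k → trans (sym (*-distribʳ-sum {N} (g k i) (λ j → v j * f j k)))
             (trans (*-congʳ (dep k)) (zeroˡ (g k i)))) ⟩
      0# ∎) }

-- Evaluation of formal polynomials at points.

module Evaluation {c ℓ : Level} (F : Field c ℓ) where
  open Field F hiding (zero)
  open Poly F
  open LinearAlgebra F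
  open Algebra.Properties.Semiring.Sum semiring using (sum; sum-cong-≋)
  open Algebra.Properties.CommutativeMonoid.Sum *-commutativeMonoid using () renaming (sum to product)
  open Algebra.Properties.CommutativeSemigroup *-commutativeSemigroup using () renaming (interchange to *-interchange)
  open Algebra.Properties.Semiring.Exp semiring using (_^_; ^-congˡ; ^-homo-*)
  open Algebra.Properties.Ring ring using (-‿distribˡ-*; -0#≈0#; -‿+-comm)
  open Relation.Binary.Reasoning.Setoid setoid

  Point : ℕ → Set c
  Point m = Fin m → Carrier

  evalᵐ : ∀ {m} → Point m → Monomial m → Carrier
  evalᵐ ρ []      = 1#
  evalᵐ ρ (e ∷ μ) = ρ zero ^ e * evalᵐ (ρ ∘ suc) μ

  eval : ∀ {m} → Point m → MPoly m → Carrier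
  eval ρ []            = 0#
  eval ρ ((a , μ) ∷ p) = a * evalᵐ ρ μ + eval ρ p

  evalᵐ-+ : ∀ {m} (ρ : Point m) μ ν → evalᵐ ρ (zipWith ℕ._+_ μ ν) ≈ evalᵐ ρ μ * evalᵐ ρ ν
  evalᵐ-+ ρ []      []      = sym (*-identityˡ 1#)
  evalᵐ-+ ρ (d ∷ μ) (e ∷ ν) =
    trans (*-cong (^-homo-* (ρ zero) d e) (evalᵐ-+ (ρ ∘ suc) μ ν)) (*-interchange _ _ _ _)

  evalᵐ-0 : ∀ {m} (ρ : Point m) → evalᵐ ρ (replicate m 0) ≈ 1#
  evalᵐ-0 {zero}  ρ = refl
  evalᵐ-0 {suc m} ρ = trans (*-identityˡ _) (evalᵐ-0 (ρ ∘ suc))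

  evalᵐ-xpow : ∀ {m} (ρ : Point m) i e → evalᵐ ρ (xpow i e) ≈ ρ i ^ e
  evalᵐ-xpow ρ zero    e = trans (*-congˡ (evalᵐ-0 (ρ ∘ suc))) (*-identityʳ _)
  evalᵐ-xpow ρ (suc i) e = trans (*-identityˡ _) (evalᵐ-xpow (ρ ∘ suc) i e)

  eval-1 : ∀ {m} (ρ : Point m) → eval ρ 1ₚ ≈ 1#
  eval-1 ρ = trans (+-identityʳ _) (trans (*-identityˡ _) (evalᵐ-0 ρ))

  eval-var : ∀ {m} (ρ : Point m) i → eval ρ (var i) ≈ ρ i
  eval-var ρ i = trans (+-identityʳ _) (trans (*-identityˡ _) (trans (evalᵐ-xpow ρ i 1) (*-identityʳ _)))

  eval-+ : ∀ {m} (ρ : Point m) p q → eval ρ (p +ₚ q) ≈ eval ρ p + eval ρ q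
  eval-+ ρ []            q = sym (+-identityˡ _)
  eval-+ ρ ((a , μ) ∷ p) q = trans (+-congˡ (eval-+ ρ p q)) (sym (+-assoc _ _ _))

  eval-scale : ∀ {m} (ρ : Point m) a μ (g : Carrier × Monomial m → Carrier × Monomial m) →
               (∀ t → g t ≡ (a * proj₁ t , zipWith ℕ._+_ μ (proj₂ t))) →
               ∀ q → eval ρ (map g q) ≈ a * evalᵐ ρ μ * eval ρ q
  eval-scale ρ a μ g g≡ []            = sym (zeroʳ _)
  eval-scale ρ a μ g g≡ ((b , ν) ∷ q) = begin
    eval ρ (g (b , ν) ∷ map g q)
      ≡⟨ ≡.cong (λ t → eval ρ (t ∷ map g q)) (g≡ (b , ν)) ⟩
    a * b * evalᵐ ρ (zipWith ℕ._+_ μ ν) + eval ρ (map g q)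
      ≈⟨ +-cong (trans (*-congˡ (evalᵐ-+ ρ μ ν)) (*-interchange _ _ _ _)) (eval-scale ρ a μ g g≡ q) ⟩
    a * evalᵐ ρ μ * (b * evalᵐ ρ ν) + a * evalᵐ ρ μ * eval ρ q
      ≈⟨ distribˡ _ _ _ ⟨
    a * evalᵐ ρ μ * (b * evalᵐ ρ ν + eval ρ q) ∎

  eval-* : ∀ {m} (ρ : Point m) p q → eval ρ (p *ₚ q) ≈ eval ρ p * eval ρ q
  eval-* ρ []            q = sym (zeroˡ _)
  eval-* ρ ((a , μ) ∷ p) q = begin
    eval ρ (((a , μ) ∷ p) *ₚ q)                     ≈⟨ eval-+ ρ (map scaled q) (p *ₚ q) ⟩
    eval ρ (map scaled q) + eval ρ (p *ₚ q)         ≈⟨ +-cong (eval-scale ρ a μ scaled (λ _ → ≡.refl) q) (eval-* ρ p q) ⟩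
    a * evalᵐ ρ μ * eval ρ q + eval ρ p * eval ρ q  ≈⟨ distribʳ _ _ _ ⟨
    eval ρ ((a , μ) ∷ p) * eval ρ q                 ∎
    where
    scaled : Carrier × Monomial _ → Carrier × Monomial _
    scaled t = a * proj₁ t , zipWith ℕ._+_ μ (proj₂ t)

  eval-Σ : ∀ {m} (ρ : Point m) n f → eval ρ (Σₚ n f) ≈ sum {n} (eval ρ ∘ f)
  eval-Σ ρ n f = go n (λ i → i)
    where
    -- `allFin n` is `tabulate` of the identity; its tail tabulates `suc`, so the induction needs a
    -- general `g`.
    go : ∀ k (g : Fin k → Fin n) →
         eval ρ (foldr (λ i acc → f i +ₚ acc) 0ₚ (tabulate g)) ≈ sum {k} (eval ρ ∘ f ∘ g)
    go zero    g = refl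
    go (suc k) g = trans (eval-+ ρ (f (g zero)) _) (+-congˡ (go k (g ∘ suc)))

  eval-Π : ∀ {m} (ρ : Point m) n f → eval ρ (Πₚ n f) ≈ product {n} (eval ρ ∘ f)
  eval-Π ρ n f = go n (λ i → i)
    where
    go : ∀ k (g : Fin k → Fin n) →
         eval ρ (foldr (λ i acc → f i *ₚ acc) 1ₚ (tabulate g)) ≈ product {k} (eval ρ ∘ f ∘ g)
    go zero    g = eval-1 ρ
    go (suc k) g = trans (eval-* ρ (f (g zero)) _) (*-congˡ (go k (g ∘ suc)))

  -- The helper of `embed` is local and cannot be named; unification against the
  -- unfolding of `embed`, generalised over the arguments of the helper, recovers it.
  mutual
    embed-from : ∀ {m} → Fin m → UPoly → ℕ → UPoly → MPoly m
    embed-from = _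

    embed-∷ : ∀ {m} (i : Fin m) a as →
              embed i (a ∷ as) ≡ (a , xpow i 0) ∷ embed-from i (a ∷ as) 1 as
    embed-∷ i a as with 1 | a ∷ as
    ... | _ | _ = ≡.refl

  -- This is how obliviousness enters: a label in one variable sees the point only through that
  -- coordinate, as every `xpow i e` takes the value `ρ i ^ e`.
  eval-embed-cong : ∀ {m} (ρ ρ′ : Point m) i cs → ρ i ≈ ρ′ i →
                    eval ρ (embed i cs) ≈ eval ρ′ (embed i cs)
  eval-embed-cong ρ ρ′ i cs ρi≈ρ′i = go 0 cs
    where
    go : ∀ e as → eval ρ (embed-from i cs e as) ≈ eval ρ′ (embed-from i cs e as)
    go e []       = refl
    go e (a ∷ as) = +-cong (*-congˡ (begin
      evalᵐ ρ (xpow i e)   ≈⟨ evalᵐ-xpow ρ i e ⟩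
      ρ i ^ e              ≈⟨ ^-congˡ e ρi≈ρ′i ⟩
      ρ′ i ^ e             ≈⟨ evalᵐ-xpow ρ′ i e ⟨
      evalᵐ ρ′ (xpow i e)  ∎)) (go (suc e) as)

  -- Coefficientwise equal polynomials have equal values.

  remove : ∀ {m} → Monomial m → MPoly m → MPoly m
  remove ν = filter λ t → ¬? (≡-dec ℕ._≟_ (proj₂ t) ν)

  coeff-∷-≢ : ∀ {m} a {μ ν : Monomial m} p → μ ≢ ν → coeff ((a , μ) ∷ p) ν ≡ coeff p ν
  coeff-∷-≢ a {μ} {ν} p μ≢ν with ≡-dec ℕ._≟_ μ ν
  ... | yes μ≡ν = contradiction μ≡ν μ≢ν
  ... | no _    = ≡.refl

  -- A formal sum may repeat a monomial, so all terms at `ν` are gathered at once, and their scalars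
  -- add up to the coefficient.
  eval-remove : ∀ {m} (ρ : Point m) ν p → eval ρ p ≈ coeff p ν * evalᵐ ρ ν + eval ρ (remove ν p)
  eval-remove ρ ν [] = sym (trans (+-identityʳ _) (zeroˡ _))
  eval-remove ρ ν ((a , μ) ∷ p) with ≡-dec ℕ._≟_ μ ν
  ... | yes ≡.refl = begin
    a * evalᵐ ρ ν + eval ρ p
      ≈⟨ +-congˡ (eval-remove ρ ν p) ⟩
    a * evalᵐ ρ ν + (coeff p ν * evalᵐ ρ ν + eval ρ (remove ν p))
      ≈⟨ +-assoc _ _ _ ⟨
    a * evalᵐ ρ ν + coeff p ν * evalᵐ ρ ν + eval ρ (remove ν p)
      ≈⟨ +-congʳ (distribʳ _ _ _) ⟨
    (a + coeff p ν) * evalᵐ ρ ν + eval ρ (remove ν p) ∎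
  ... | no _ = begin
    a * evalᵐ ρ μ + eval ρ p
      ≈⟨ +-congˡ (eval-remove ρ ν p) ⟩
    a * evalᵐ ρ μ + (coeff p ν * evalᵐ ρ ν + eval ρ (remove ν p))
      ≈⟨ +-assoc _ _ _ ⟨
    a * evalᵐ ρ μ + coeff p ν * evalᵐ ρ ν + eval ρ (remove ν p)
      ≈⟨ +-congʳ (+-comm _ _) ⟩
    coeff p ν * evalᵐ ρ ν + a * evalᵐ ρ μ + eval ρ (remove ν p)
      ≈⟨ +-assoc _ _ _ ⟩
    coeff p ν * evalᵐ ρ ν + (a * evalᵐ ρ μ + eval ρ (remove ν p)) ∎

  coeff-remove-≡ : ∀ {m} (ν : Monomial m) p → coeff (remove ν p) ν ≡ 0#
  coeff-remove-≡ ν []            = ≡.refl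
  coeff-remove-≡ ν ((a , μ) ∷ p) with ≡-dec ℕ._≟_ μ ν
  ... | yes _  = coeff-remove-≡ ν p
  ... | no μ≢ν = ≡.trans (coeff-∷-≢ a (remove ν p) μ≢ν) (coeff-remove-≡ ν p)

  coeff-remove-≢ : ∀ {m} {ν κ : Monomial m} p → ν ≢ κ → coeff (remove ν p) κ ≡ coeff p κ
  coeff-remove-≢ []            ν≢κ = ≡.refl
  coeff-remove-≢ {ν = ν} {κ} ((a , μ) ∷ p) ν≢κ with ≡-dec ℕ._≟_ μ ν
  ... | yes ≡.refl = ≡.trans (coeff-remove-≢ p ν≢κ) (≡.sym (coeff-∷-≢ a p ν≢κ))
  ... | no _ with ≡-dec ℕ._≟_ μ κ
  ...   | yes _ = ≡.cong (a +_) (coeff-remove-≢ p ν≢κ)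
  ...   | no _  = coeff-remove-≢ p ν≢κ

  -- Gathering the terms at the first monomial contributes zero and leaves a shorter list whose
  -- coefficients still vanish. That list is not a subterm, so the recursion runs on the length
  -- bound `N`.
  eval-0 : ∀ {m} (ρ : Point m) N (p : MPoly m) → length p ℕ.≤ N → p ≈ₚ 0ₚ → eval ρ p ≈ 0#
  eval-0 ρ N       []                _  _   = refl
  eval-0 ρ (suc N) p@((a , ν) ∷ p′) le p≈0 = begin
    eval ρ p                                       ≈⟨ eval-remove ρ ν p ⟩
    coeff p ν * evalᵐ ρ ν + eval ρ (remove ν p)    ≈⟨ +-cong (trans (*-congʳ (p≈0 ν)) (zeroˡ _))
                                                        (eval-0 ρ N (remove ν p) shorter vanishes) ⟩
    0# + 0#                                        ≈⟨ +-identityˡ 0# ⟩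
    0#                                             ∎
    where
    shorter : length (remove ν p) ℕ.≤ N
    shorter = ℕ.s≤s⁻¹ (ℕ.≤-trans (filter-notAll (λ t → ¬? (≡-dec ℕ._≟_ (proj₂ t) ν)) p (here λ ν≢ν → ν≢ν ≡.refl)) le)
    vanishes : remove ν p ≈ₚ 0ₚ
    vanishes κ with ≡-dec ℕ._≟_ ν κ
    ... | yes ≡.refl = reflexive (coeff-remove-≡ ν p)
    ... | no ν≢κ     = trans (reflexive (coeff-remove-≢ p ν≢κ)) (p≈0 κ)

  negate : ∀ {m} → MPoly m → MPoly m
  negate = map λ t → - proj₁ t , proj₂ t

  coeff-+ : ∀ {m} (p q : MPoly m) μ → coeff (p +ₚ q) μ ≈ coeff p μ + coeff q μ
  coeff-+ []            q μ = sym (+-identityˡ _)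
  coeff-+ ((a , ν) ∷ p) q μ with ≡-dec ℕ._≟_ ν μ
  ... | yes _ = trans (+-congˡ (coeff-+ p q μ)) (sym (+-assoc _ _ _))
  ... | no _  = coeff-+ p q μ

  coeff-negate : ∀ {m} (p : MPoly m) μ → coeff (negate p) μ ≈ - coeff p μ
  coeff-negate []            μ = sym -0#≈0#
  coeff-negate ((a , ν) ∷ p) μ with ≡-dec ℕ._≟_ ν μ
  ... | yes _ = trans (+-congˡ (coeff-negate p μ)) (-‿+-comm _ _)
  ... | no _  = coeff-negate p μ

  eval-negate : ∀ {m} (ρ : Point m) p → eval ρ (negate p) ≈ - eval ρ p
  eval-negate ρ []            = sym -0#≈0#
  eval-negate ρ ((a , ν) ∷ p) =
    trans (+-cong (sym (-‿distribˡ-* _ _)) (eval-negate ρ p)) (-‿+-comm _ _)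

  -- Equality of coefficients does not relate the two lists term by term, so the formal difference
  -- is formed and `eval-0` applied to it.
  eval-cong : ∀ {m} (ρ : Point m) p q → p ≈ₚ q → eval ρ p ≈ eval ρ q
  eval-cong ρ p q p≈q = begin
    eval ρ p                            ≈⟨ +-identityʳ _ ⟨
    eval ρ p + 0#                       ≈⟨ +-congˡ (-‿inverseˡ (eval ρ q)) ⟨
    eval ρ p + (- eval ρ q + eval ρ q)  ≈⟨ +-assoc _ _ _ ⟨
    eval ρ p - eval ρ q + eval ρ q      ≈⟨ +-congʳ (+-congˡ (eval-negate ρ q)) ⟨
    eval ρ p + eval ρ (negate q) + eval ρ q  ≈⟨ +-congʳ (eval-+ ρ p (negate q)) ⟨
    eval ρ (p +ₚ negate q) + eval ρ q   ≈⟨ +-congʳ (eval-0 ρ _ (p +ₚ negate q) ℕ.≤-refl difference) ⟩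
    0# + eval ρ q                       ≈⟨ +-identityˡ _ ⟩
    eval ρ q                            ∎
    where
    difference : (p +ₚ negate q) ≈ₚ 0ₚ
    difference μ = trans (coeff-+ p (negate q) μ)
      (trans (+-cong (p≈q μ) (coeff-negate q μ)) (-‿inverseʳ _))

-- `funToFin` is a left inverse, but it must first be shown to give the same code to functions that
-- agree only pointwise.
finToFun-injective : ∀ {m n} (a b : Fin (m ℕ.^ n)) →
                     (∀ i → finToFun {m} {n} a i ≡ finToFun b i) → a ≡ b
finToFun-injective {m} {n} a b eq =
  ≡.trans (≡.sym (funToFin-finToFin {n} a)) (≡.trans (funToFin-cong n eq) (funToFin-finToFin {n} b))
  where
  funToFin-cong : ∀ n {f g : Fin n → Fin m} → (∀ i → f i ≡ g i) → funToFin f ≡ funToFin g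
  funToFin-cong zero    f≗g = ≡.refl
  funToFin-cong (suc n) f≗g = ≡.cong₂ combine (f≗g zero) (funToFin-cong n (f≗g ∘ suc))

-- Alternating programs factor through few dimensions.

module Rank {c ℓ : Level} (F : Field c ℓ) where
  open Field F hiding (zero)
  open Poly F
  open LinearAlgebra F
  open Evaluation F
  open Algebra.Properties.Semiring.Sum semiring
    using (sum; sum-cong-≋; ∑-comm; *-distribˡ-sum; *-distribʳ-sum)
  open Relation.Binary.Reasoning.Setoid setoid

  sum-++ : ∀ m n (f : Fin (m ℕ.+ n) → Carrier) →
           sum {m ℕ.+ n} f ≈ sum {m} (λ i → f (i ↑ˡ n)) + sum {n} (λ i → f (m ↑ʳ i))
  sum-++ zero    n f = sym (+-identityˡ _)
  sum-++ (suc m) n f = trans (+-congˡ (sum-++ m n (f ∘ suc))) (sym (+-assoc _ _ _))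

  sum-combine : ∀ a r (f : Fin (a ℕ.* r) → Carrier) →
                sum {a ℕ.* r} f ≈ sum {a} λ i → sum {r} λ k → f (combine i k)
  sum-combine zero    r f = refl
  sum-combine (suc a) r f =
    trans (sum-++ r (a ℕ.* r) f) (+-congˡ (sum-combine a r (f ∘ (r ↑ʳ_))))

  δ : ∀ {a} → Fin a → Fin a → Carrier
  δ i j with i ≟ j
  ... | yes _ = 1#
  ... | no _  = 0#

  δ-≡ : ∀ {a} (i : Fin a) → δ i i ≡ 1#
  δ-≡ i with i ≟ i
  ... | yes _  = ≡.refl
  ... | no i≢i = contradiction ≡.refl i≢i

  δ-≢ : ∀ {a} {i j : Fin a} → i ≢ j → δ i j ≡ 0#
  δ-≢ {i = i} {j} i≢j with i ≟ j
  ... | yes i≡j = contradiction i≡j i≢j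
  ... | no _    = ≡.refl

  -- The second factor does not depend on u: layers of edges that read only α can
  -- be absorbed into the first one.
  record Factored {a} {I : Set} (r : ℕ) (h : Fin a → I → I → Carrier) : Set (c ⊔ ℓ) where
    field
      left     : Fin a → I → Fin r → Carrier
      right    : Fin r → I → Carrier
      factored : ∀ u α β → h u α β ≈ sum {r} λ k → left u α k * right k β

  factored-layer : ∀ {a b r} {I : Set} {h : Fin b → I → I → Carrier} {h′ : Fin a → I → I → Carrier}
                   (M : Fin a → Fin b → I → Carrier) →
                   (∀ u α β → h′ u α β ≈ sum {b} λ t → M u t α * h t α β) →
                   Factored r h → Factored r h′
  factored-layer {b = b} {r} {h = h} {h′} M h′≈Mh R = record
    { left = λ u α k → sum {b} λ t → M u t α * left t α k
    ; right = right
    ; factored = λ u α β → begin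
        h′ u α β
          ≈⟨ h′≈Mh u α β ⟩
        sum {b} (λ t → M u t α * h t α β)
          ≈⟨ sum-cong-≋ {b} (λ t → trans (*-congˡ (factored t α β))
               (trans (*-distribˡ-sum {r} (M u t α) (λ k → left t α k * right k β))
                 (sum-cong-≋ {r} λ k → sym (*-assoc _ _ _)))) ⟩
        sum {b} (λ t → sum {r} λ k → M u t α * left t α k * right k β)
          ≈⟨ ∑-comm {b} {r} (λ t k → M u t α * left t α k * right k β) ⟩
        sum {r} (λ k → sum {b} λ t → M u t α * left t α k * right k β)
          ≈⟨ sum-cong-≋ {r} (λ k → *-distribʳ-sum {b} (right k β) (λ t → M u t α * left t α k)) ⟨
        sum {r} (λ k → sum {b} (λ t → M u t α * left t α k) * right k β) ∎ }
    where open Factored R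

  -- Once the assignments trade roles, the factor in β is the one that depends on `u`, which
  -- `Factored` does not allow. So the sum is taken over pairs (t, k), and `δ t u` in the factor in
  -- α selects t = u. This multiplies the dimension by `a`.
  factored-flip : ∀ {a r} {I : Set} {h : Fin a → I → I → Carrier} →
                  Factored r (λ u → flip (h u)) → Factored (a ℕ.* r) h
  factored-flip {a} {r} {h = h} R = record
    { left = λ u α i → δ (proj₁ (remQuot {a} r i)) u * right (proj₂ (remQuot {a} r i)) α
    ; right = λ i β → left (proj₁ (remQuot {a} r i)) β (proj₂ (remQuot {a} r i))
    ; factored = λ u α β → sym (begin
        sum {a ℕ.* r} (λ i → term u α β (remQuot {a} r i))
          ≈⟨ sum-combine a r (λ i → term u α β (remQuot {a} r i)) ⟩
        sum {a} (λ t → sum {r} λ k → term u α β (remQuot {a} r (combine t k)))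
          ≈⟨ sum-cong-≋ {a} (λ t → sum-cong-≋ {r} λ k →
               reflexive (≡.cong (term u α β) (remQuot-combine {a} t k))) ⟩
        sum {a} (λ t → sum {r} λ k → term u α β (t , k))
          ≈⟨ sum-single a u (λ t t≢u → sum-zero r λ k →
               trans (*-congʳ (trans (*-congʳ (reflexive (δ-≢ t≢u))) (zeroˡ _))) (zeroˡ _)) ⟩
        sum {r} (λ k → term u α β (u , k))
          ≈⟨ sum-cong-≋ {r} (λ k → trans (*-congʳ (trans (*-congʳ (reflexive (δ-≡ u))) (*-identityˡ _)))
               (*-comm _ _)) ⟩
        sum {r} (λ k → left u β k * right k α)
          ≈⟨ factored u β α ⟨
        h u α β ∎) }
    where
    open Factored R
    term : Fin a → _ → _ → Fin a × Fin r → Carrier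
    term u α β (t , k) = δ t u * right k α * left t β k

  readSequence : ∀ {m a} → ABPFrom m a → List (Fin m)
  readSequence done            = []
  readSequence (layer b v M A) = v ∷ readSequence A

  width-source : ∀ {m a w} (A : ABPFrom m a) → Width≤ A w → a ℕ.≤ w
  width-source done            a≤w       = a≤w
  width-source (layer b v M A) (a≤w , _) = a≤w

  module _ {m n : ℕ} (e : Bool → Fin n → Fin m) (disjoint : ∀ i j → e true i ≢ e false j) where
    open Alternation e disjoint

    reads≡occurrences : ∀ {a} (A : ABPFrom m a) v → reads A v ≡ occurrences v (readSequence A)
    reads≡occurrences done            i = ≡.refl
    reads≡occurrences (layer b v M A) i with v ≟ i
    ... | yes _ = ≡.cong suc (reads≡occurrences A i)
    ... | no _  = reads≡occurrences A i

    -- `P α β` is a point whose coordinates depend on α only at symbols of `W true` and on β only at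
    -- symbols of `W false`.
    module _ {I : Set} (i₀ : I) (W : Family) (P : I → I → Point m)
             (independentʳ : ∀ v → Avoids (W false) false [ v ] → ∀ α β β′ → P α β v ≡ P α β′ v)
             (independentˡ : ∀ v → Avoids (W true) true [ v ] → ∀ α α′ β → P α β v ≡ P α′ β v)
             where

      -- On side `s` the first argument is the assignment to the `s`-symbols, so the labels of a
      -- block on side `s` depend on the first argument alone.
      oriented : Bool → I → I → Point m
      oriented true  = P
      oriented false = flip P

      oriented-not : ∀ s α β → oriented (not s) β α ≡ oriented s α β
      oriented-not true  α β = ≡.refl
      oriented-not false α β = ≡.refl

      independent : ∀ s v → Avoids (W (not s)) (not s) [ v ] →
                    ∀ α β β′ → oriented s α β v ≡ oriented s α β′ v
      independent true  v av α β β′ = independentʳ v av α β β′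
      independent false v av α β β′ = independentˡ v av β β′ α

      value : ∀ {a} → ABPFrom m a → Bool → Fin a → I → I → Carrier
      value A s u α β = eval (oriented s α β) (pathSum A u)

      -- Induction along the blocks: a layer within the current block is absorbed into the left
      -- factor at no cost, while each `switch` flips the factorization and costs the size of one
      -- vertex layer, at most `w`.
      alternating⇒factored : ∀ {a s t w} (A : ABPFrom m a) → Alt W s t (readSequence A) → Width≤ A w →
                             ∃ λ r → r ℕ.≤ w ℕ.^ t × Factored r (value A s)
      alternating⇒factored {s = s} done nil _ = 1 , ℕ.≤-refl , record
        { left = λ _ _ _ → 1# ; right = λ _ _ → 1#
        ; factored = λ { zero α β → trans (eval-1 (oriented s α β)) (sym (trans (+-identityʳ _) (*-identityˡ 1#))) } }
      alternating⇒factored {s = s} (layer b v M A) (read av alt) (_ , width)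
        with alternating⇒factored A alt width
      ... | r , r≤ , R = r , r≤ , factored-layer
        -- The label does not depend on β, so `i₀` stands in for it.
        (λ u t α → eval (oriented s α i₀) (embed v (M u t)))
        (λ u α β → trans (eval-Σ (oriented s α β) b (λ t → embed v (M u t) *ₚ pathSum A t))
          (sum-cong-≋ {b} λ t → trans (eval-* (oriented s α β) (embed v (M u t)) (pathSum A t))
            (*-congʳ (eval-embed-cong (oriented s α β) (oriented s α i₀) v (M u t)
              (reflexive (independent s v av α β i₀))))))
        R
      alternating⇒factored {a = a} {s = s} {t = suc t} A (switch alt) width
        with alternating⇒factored A alt width
      ... | r , r≤ , R = a ℕ.* r , ℕ.*-mono-≤ (width-source A width) r≤ , factored-flip record
        { left = Factored.left R ; right = Factored.right R
        ; factored = λ u α β → trans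
            (reflexive (≡.cong (λ ρ → eval ρ (pathSum A u)) (≡.sym (oriented-not s β α))))
            (Factored.factored R u α β) }

  -- Restricting the polynomial to a diagonal matrix, and the width bound.

  module _ (n : ℕ) .{{_ : NonZero n}} where

    open Algebra.Properties.CommutativeMonoid.Sum *-commutativeMonoid
      using () renaming (sum to product; sum-cong-≋ to product-cong; sum-remove to product-remove)

    -- `i₀` is the summand that survives, `κ` lists the indices j of its factors that stay free, and
    -- `σ` sends j to the y-index in factor j.
    module Restriction (i₀ : Fin n) {s} (κ : Fin s → Fin n) (κ-injective : ∀ {i j} → κ i ≡ κ j → i ≡ j) where

      σ : Fin n → Fin n
      σ = rot n (toℕ i₀ ℕ.+ 1)

      I : Set
      I = Fin s → Fin 2

      -- x + y vanishes for different indices and is ±1 for equal ones.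
      xValue yValue : Fin 2 → Carrier
      xValue 0F = 0#
      xValue 1F = 1#
      yValue 0F = - 1#
      yValue 1F = 0#

      -- The defaults 1 for x and 0 for y turn every factor that is not free into 1.
      xs ys : I → Fin n → Carrier
      xs α j with any? (λ i → κ i ≟ j)
      ... | yes (i , _) = xValue (α i)
      ... | no _        = 1#
      ys β j with any? (λ i → σ (κ i) ≟ j)
      ... | yes (i , _) = yValue (β i)
      ... | no _        = 0#

      point : I → I → Point (n ℕ.+ n ℕ.+ n)
      point α β v with splitAt (n ℕ.+ n) v
      -- The z-variables form a unit vector, which selects the summand `i₀`.
      ... | inj₂ i = δ i i₀
      ... | inj₁ v′ with splitAt n v′
      ...   | inj₁ j = xs α j
      ...   | inj₂ j = ys β j

      point-X : ∀ α β j → point α β (X n j) ≡ xs α j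
      point-X α β j rewrite splitAt-↑ˡ (n ℕ.+ n) (j ↑ˡ n) n | splitAt-↑ˡ n j n = ≡.refl

      point-Y : ∀ α β j → point α β (Y n j) ≡ ys β j
      point-Y α β j rewrite splitAt-↑ˡ (n ℕ.+ n) (n ↑ʳ j) n | splitAt-↑ʳ n n j = ≡.refl

      point-Z : ∀ α β i → point α β (Z n i) ≡ δ i i₀
      point-Z α β i rewrite splitAt-↑ʳ (n ℕ.+ n) n i = ≡.refl

      point-independentʳ : ∀ v → (∀ i → Y n (σ (κ i)) ≢ v) → ∀ α β β′ → point α β v ≡ point α β′ v
      point-independentʳ v ≢v α β β′ with splitAt (n ℕ.+ n) v in eq
      ... | inj₂ i = ≡.refl
      ... | inj₁ v′ with splitAt n v′ in eq′
      ...   | inj₁ j = ≡.refl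
      ...   | inj₂ j with any? (λ i → σ (κ i) ≟ j)
      ...     | no _             = ≡.refl
      ...     | yes (i , ≡.refl) = contradiction
        (≡.trans (≡.cong (_↑ˡ n) (splitAt⁻¹-↑ʳ {n} eq′)) (splitAt⁻¹-↑ˡ {n ℕ.+ n} eq)) (≢v i)

      point-independentˡ : ∀ v → (∀ i → X n (κ i) ≢ v) → ∀ α α′ β → point α β v ≡ point α′ β v
      point-independentˡ v ≢v α α′ β with splitAt (n ℕ.+ n) v in eq
      ... | inj₂ i = ≡.refl
      ... | inj₁ v′ with splitAt n v′ in eq′
      ...   | inj₂ j = ≡.refl
      ...   | inj₁ j with any? (λ i → κ i ≟ j)
      ...     | no _             = ≡.refl
      ...     | yes (i , ≡.refl) = contradiction
        (≡.trans (≡.cong (_↑ˡ n) (splitAt⁻¹-↑ˡ {n} eq′)) (splitAt⁻¹-↑ˡ {n ℕ.+ n} eq)) (≢v i)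

      factor : I → I → Fin n → Carrier
      factor α β j = xs α j + ys β (σ j)

      eval-Q : ∀ α β → eval (point α β) (Q n) ≈ product {n} (factor α β)
      eval-Q α β = begin
        eval ρ (Q n)
          ≈⟨ eval-Σ ρ n (λ i → var (Z n i) *ₚ Πₚ n (linear i)) ⟩
        sum {n} (λ i → eval ρ (var (Z n i) *ₚ Πₚ n (linear i)))
          ≈⟨ sum-cong-≋ {n} (λ i → trans (eval-* ρ (var (Z n i)) (Πₚ n (linear i)))
               (*-cong (trans (eval-var ρ (Z n i)) (reflexive (point-Z α β i))) (eval-Π ρ n (linear i)))) ⟩
        sum {n} (λ i → δ i i₀ * product {n} (eval ρ ∘ linear i))
          ≈⟨ sum-single n i₀ (λ i i≢i₀ → trans (*-congʳ (reflexive (δ-≢ i≢i₀))) (zeroˡ _)) ⟩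
        δ i₀ i₀ * product {n} (eval ρ ∘ linear i₀)
          ≈⟨ trans (*-congʳ (reflexive (δ-≡ i₀))) (*-identityˡ _) ⟩
        product {n} (eval ρ ∘ linear i₀)
          ≈⟨ product-cong {n} (λ j → trans (eval-+ ρ (var (X n j)) (var (Y n (shifted i₀ j))))
               (+-cong (trans (eval-var ρ (X n j)) (reflexive (point-X α β j)))
                 (trans (eval-var ρ (Y n (shifted i₀ j))) (reflexive (≡.trans (point-Y α β (shifted i₀ j))
                   -- The y-index is written (j + i₀) + 1 in `Q` and j + (i₀ + 1) in `σ`.
                   (≡.cong (λ k → ys β (k mod n)) (ℕ.+-assoc (toℕ j) (toℕ i₀) 1))))))) ⟩
        product {n} (factor α β) ∎
        where
        ρ = point α β
        linear : Fin n → Fin n → MPoly (n ℕ.+ n ℕ.+ n)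
        shifted : Fin n → Fin n → Fin n
        shifted i j = (toℕ j ℕ.+ toℕ i ℕ.+ 1) mod n
        linear i j = var (X n j) +ₚ var (Y n (shifted i j))

      σ∘κ-injective : ∀ {i j} → σ (κ i) ≡ σ (κ j) → i ≡ j
      σ∘κ-injective = κ-injective ∘ rot-injective n _

      -- The searches in `xs` and `ys` return some index with the right image; injectivity of `κ`
      -- and of `σ ∘ κ` shows that it is `i`.
      factor-κ : ∀ α β i → factor α β (κ i) ≡ xValue (α i) + yValue (β i)
      factor-κ α β i with any? (λ i′ → κ i′ ≟ κ i) | any? (λ i′ → σ (κ i′) ≟ σ (κ i))
      ... | no ∄        | _           = contradiction (i , ≡.refl) ∄
      ... | _           | no ∄        = contradiction (i , ≡.refl) ∄
      ... | yes (j , p) | yes (k , q) =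
        ≡.cong₂ (λ j k → xValue (α j) + yValue (β k)) (κ-injective p) (σ∘κ-injective q)

      -- Both defaults apply: `σ` is injective, so `σ j` is not the image of a free index either.
      factor-≢ : ∀ α β j → (∀ i → κ i ≢ j) → factor α β j ≡ 1# + 0#
      factor-≢ α β j ∉κ with any? (λ i → κ i ≟ j) | any? (λ i → σ (κ i) ≟ σ j)
      ... | yes (i , p) | _           = contradiction p (∉κ i)
      ... | _           | yes (i , p) = contradiction (rot-injective n _ p) (∉κ i)
      ... | no _        | no _        = ≡.refl

      product-nonzero : ∀ k {f : Fin k → Carrier} → (∀ j → ¬ f j ≈ 0#) → ¬ product {k} f ≈ 0#
      product-nonzero zero    f≉0 = 1≉0
      product-nonzero (suc k) f≉0 = nonzero-* (f≉0 zero) (product-nonzero k (f≉0 ∘ suc))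

      product-zero : ∀ k {f : Fin k → Carrier} j → f j ≈ 0# → product {k} f ≈ 0#
      product-zero (suc k) {f} j fj≈0 = trans (product-remove {k} {j} f) (trans (*-congʳ fj≈0) (zeroˡ _))

      1+0≉0 : ¬ 1# + 0# ≈ 0#
      1+0≉0 = 1≉0 ∘ trans (sym (+-identityʳ 1#))

      -- Free factors are -1 or 1 when both assignments agree, the others are 1, and a field has no
      -- zero divisors.
      diagonal : ∀ α → ¬ product {n} (factor α α) ≈ 0#
      diagonal α = product-nonzero n nonzero
        where
        same : ∀ b → ¬ xValue b + yValue b ≈ 0#
        same 0F 0-1≈0 = 1≉0 (begin
          1#               ≈⟨ +-identityˡ 1# ⟨
          0# + 1#          ≈⟨ +-congʳ 0-1≈0 ⟨
          0# + - 1# + 1#   ≈⟨ +-assoc 0# (- 1#) 1# ⟩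
          0# + (- 1# + 1#) ≈⟨ +-congˡ (-‿inverseˡ 1#) ⟩
          0# + 0#          ≈⟨ +-identityˡ 0# ⟩
          0#               ∎)
        same 1F = 1+0≉0
        nonzero : ∀ j → ¬ factor α α j ≈ 0#
        nonzero j = go (any? (λ i → κ i ≟ j))
          where
          go : Dec (∃ λ i → κ i ≡ j) → ¬ factor α α j ≈ 0#
          go (yes (i , ≡.refl)) = same (α i) ∘ trans (reflexive (≡.sym (factor-κ α α i)))
          go (no ∄) = 1+0≉0 ∘ trans (reflexive (≡.sym (factor-≢ α α j λ i p → ∄ (i , p))))

      off-diagonal : ∀ α β i → α i ≢ β i → product {n} (factor α β) ≈ 0#
      off-diagonal α β i αi≢βi =
        product-zero n (κ i) (trans (reflexive (factor-κ α β i)) (different (α i) (β i) αi≢βi))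
        where
        different : ∀ a b → a ≢ b → xValue a + yValue b ≈ 0#
        different 0F 0F a≢b = contradiction ≡.refl a≢b
        different 0F 1F _   = +-identityˡ 0#
        different 1F 0F _   = -‿inverseʳ 1#
        different 1F 1F a≢b = contradiction ≡.refl a≢b

    X≢Y : ∀ i j → X n i ≢ Y n j
    X≢Y i j eq = contradiction
      (≡.trans (≡.sym (splitAt-↑ˡ n i n))
        (≡.trans (≡.cong (splitAt n) (↑ˡ-injective n (i ↑ˡ n) (n ↑ʳ j) eq)) (splitAt-↑ʳ n n j)))
      λ ()

    symbol : Bool → Fin n → Fin (n ℕ.+ n ℕ.+ n)
    symbol true  = X n
    symbol false = Y n

    module Al = Alternation symbol X≢Y

    width-bound : ∀ k w (A : ABP (n ℕ.+ n ℕ.+ n)) → ReadK A k → Width≤ A w → computed A ≈ₚ Q n →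
                  2 ℕ.^ n ℕ.≤ w ℕ.^ (32 ℕ.* k ℕ.^ (5 ℕ.* k))
    width-bound k w A readK width A≈Q =
      power-bound n (2 ℕ.^ (2 ℕ.* k)) (# U) (# V) s w Sub.t k
        (ℕ.≤-trans (ℕ.≤-reflexive (≡.sym (#-full n))) (Sub.large true))
        (ℕ.≤-trans (ℕ.≤-reflexive (≡.sym (#-full n))) (Sub.large false))
        (ℕ.≤-trans (ℕ.≤-reflexive (≡.sym (matches-total n U V))) (proj₂ dense))
        (ℕ.≤-trans 2^s≤r (proj₁ (proj₂ rank))) Sub.t≤N ≡.refl
      where
      -- The source layer has one vertex, so 1 ≤ w; monotonicity of powers of w in the exponent
      -- relies on this.
      instance
        w-nonZero : NonZero w
        w-nonZero = ℕ.>-nonZero (width-source A width)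
      twice : ∀ v v′ → Al.occurrences v (readSequence A) ℕ.+ Al.occurrences v′ (readSequence A) ℕ.≤ 2 ℕ.* k
      twice v v′ = ℕ.≤-trans (ℕ.+-mono-≤ (once v) (once v′)) (ℕ.≤-reflexive (≡.cong (k ℕ.+_) (≡.sym (ℕ.+-identityʳ k))))
        where
        once : ∀ v → Al.occurrences v (readSequence A) ℕ.≤ k
        once v = ℕ.≤-trans (ℕ.≤-reflexive (≡.sym (reads≡occurrences symbol X≢Y A v))) (readK v)
      -- An x- and a y-variable together are read at most 2k times, which bounds the alternations by
      -- 2k and the loss in either set by the factor 2^(2k).
      module Sub = Al.Subfamily (Al.few-alternations (2 ℕ.* k) (λ _ _ → true) (readSequence A) λ i j _ _ → twice _ _)
      U V : Fin n → Bool
      U = Sub.V true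
      V = Sub.V false
      dense = above-average n (λ i → # (matches n U V (toℕ i ℕ.+ 1)))
      i₀ = proj₁ dense
      S = matches n U V (toℕ i₀ ℕ.+ 1)
      s = # S
      open Restriction i₀ (elements S) (elements-injective S)
      -- The coordinates governed by β are the y-symbols matched by `S`, and these lie in `V`.
      indʳ : ∀ v → Al.Avoids V false [ v ] → ∀ α β β′ → point α β v ≡ point α β′ v
      indʳ v av = point-independentʳ v λ i p →
        av (σ (elements S i)) (proj₂ (∧-conj (elements-∈ S i))) (here p)
      indˡ : ∀ v → Al.Avoids U true [ v ] → ∀ α α′ β → point α β v ≡ point α′ β v
      indˡ v av = point-independentˡ v λ i p →
        av (elements S i) (proj₁ (∧-conj (elements-∈ S i))) (here p)
      rank = alternating⇒factored symbol X≢Y (λ _ → 0F) Sub.V point indʳ indˡ A Sub.alt width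
      open Factored (proj₂ (proj₂ rank))
      -- The side on which the decomposition starts is unknown, so either the matrix or its
      -- transpose gets factored; both are diagonal with nonzero diagonal entries.
      entry : Bool → I → I → Carrier
      entry r = value symbol X≢Y (λ _ → 0F) Sub.V point indʳ indˡ A r zero
      entry≈ : ∀ α β → eval (point α β) (computed A) ≈ product {n} (factor α β)
      entry≈ α β = trans (eval-cong (point α β) (computed A) (Q n) A≈Q) (eval-Q α β)
      entry-diagonal : ∀ r α → ¬ entry r α α ≈ 0#
      entry-diagonal true  α = diagonal α ∘ trans (sym (entry≈ α α))
      entry-diagonal false α = diagonal α ∘ trans (sym (entry≈ α α))
      entry-off : ∀ r α β i → α i ≢ β i → entry r α β ≈ 0#
      entry-off true  α β i ≢ = trans (entry≈ α β) (off-diagonal α β i ≢)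
      entry-off false α β i ≢ = trans (entry≈ β α) (off-diagonal β α i (≢ ∘ ≡.sym))
      row : Fin (2 ℕ.^ s) → I
      row = finToFun
      2^s≤r : 2 ℕ.^ s ℕ.≤ proj₁ rank
      2^s≤r = diagonal-rank (λ a b → entry Sub.side (row a) (row b))
        (λ a → left zero (row a)) (λ l b → right l (row b))
        (λ a b → factored zero (row a) (row b))
        (λ a → entry-diagonal Sub.side (row a))
        (λ a b a≢b → let i , ≢ = differ a≢b in entry-off Sub.side (row a) (row b) i ≢)
        where
        -- Distinct codes give assignments that do not agree everywhere; as the index set is finite
        -- and equality on `Fin 2` decidable, an explicit coordinate of disagreement exists.
        differ : ∀ {a b} → a ≢ b → ∃ λ i → row a i ≢ row b i
        differ {a} {b} a≢b = ¬∀⟶∃¬ s (λ i → row a i ≡ row b i) (λ i → row a i ≟ row b i)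
          (a≢b ∘ finToFun-injective a b)

theorem4p3 : LowerBound
theorem4p3 = record { d = 32 ; C = 5 ; bound = λ F n k w A → Rank.width-bound F n k w A }
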